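{- For any first-order sentence $F$ over a first-order signature $\Sigma$ and any tuple $\mathbf{p}$ of distinct predicate symbols from $\Sigma$, an interpretation $I$ of $\Sigma$ is a $\mathbf{p}$-stable model of $F$ if and only if $I^r$ is a $\mathbf{p}^I$-stable model of the infinitary formula $\mathrm{gr}_I(F)$ over the propositional signature $A_{\Sigma,I}$.
   Context: Infinitary formulas. Let $\sigma$ be a propositional signature (a set of atoms). Infinitary formulas over $\sigma$ of rank $r$ ($r$ a nonnegative integer): every atom is a formula of rank $0$; if $\mathcal{H}$ is a set of formulas and $r$ is the smallest nonnegative integer greater than the ranks of all elements of $\mathcal{H}$, then $\mathcal{H}^\land$ and $\mathcal{H}^\lor$ are formulas of rank $r$; if $F,G$ are formulas and $r$ is the smallest nonnegative integer greater than the ranks of $F$ and $G$, then $F\rightarrow G$ is a formula of rank $r$. Abbreviations: $F\land G=\{F,G\}^\land$, $F\lor G=\{F,G\}^\lor$, $\top=\emptyset^\land$, $\bot=\emptyset^\lor$, $\neg F=F\rightarrow\bot$. An interpretation of $\sigma$ is a subset $I\subseteq\sigma$. $I\models p$ iff $p\in I$; $I\models\mathcal{H}^\land$ iff $I\models F$ for all $F\in\mathcal{H}$; $I\models\mathcal{H}^\lor$ iff $I\models F$ for some $F\in\mathcal{H}$; $I\models F\rightarrow G$ iff $I\not\models F$ or $I\models G$. The reduct $F^I$: $p^I$ is $p$ if $p\in I$ and $\bot$ otherwise; $(\mathcal{H}^\land)^I=\{G^I: G\in\mathcal{H}\}^\land$; $(\mathcal{H}^\lor)^I=\{G^I: G\in\mathcal{H}\}^\lor$;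 $(G\rightarrow H)^I$ is $G^I\rightarrow H^I$ if $I\models G\rightarrow H$, and $\bot$ otherwise. For $\mathcal{A}\subseteq\sigma$, $I\leq_{\mathcal{A}}J$ means $I\subseteq J$ and $J\setminus I\subseteq\mathcal{A}$. $I$ is an $\mathcal{A}$-stable model of an infinitary formula $F$ if $I$ is a minimal model of $F^I$ with respect to $\leq_{\mathcal{A}}$. Grounding. Let $\Sigma$ be a first-order signature and $I$ an interpretation of $\Sigma$ with non-empty domain $|I|$. First-order formulas are built from atomic formulas (including equalities) and $\bot$ using $\land,\lor,\rightarrow,\forall,\exists$, with $\neg F$ short for $F\rightarrow\bot$. For each $u\in|I|$, $u^*$ is a new object constant (the name of $u$); $\Sigma^{|I|}$ is $\Sigma$ extended by all these names, and $I$ is identified with its extension to $\Sigma^{|I|}$ that interprets each $u^*$ as $u$. $A_{\Sigma,I}$ is the set of all atomic sentences built from relation (predicate) symbols of $\Sigma$ and names of elements of $|I|$. $I^r$ is the set of all $p(u_1^*,\dots,u_k^*)\in A_{\Sigma,I}$ that are true in $I$. $\mathbf{p}^I$ is the set of those elements of $A_{\Sigma,I}$ that are built with predicate symbols from $\mathbf{p}$. The grounding $\mathrm{gr}_I(F)$ of a sentence $F$ over $\Sigma^{|I|}$ is defined by: $\mathrm{gr}_I(\bot)=\bot$; $\mathrm{gr}_I(p(t_1,\dots,t_k))=p((t_1^I)^*,\dots,(t_k^I)^*)$; $\mathrm{gr}_I(t_1=t_2)$ is $\top$ if $t_1^I=t_2^I$ and $\bot$ otherwise; $\mathrm{gr}_I(F\odot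 G)=\mathrm{gr}_I(F)\odot\mathrm{gr}_I(G)$ for $\odot\in\{\land,\lor,\rightarrow\}$; $\mathrm{gr}_I(\forall x F(x))=\{\mathrm{gr}_I(F^x_{u^*}): u\in|I|\}^\land$; $\mathrm{gr}_I(\exists x F(x))=\{\mathrm{gr}_I(F^x_{u^*}): u\in|I|\}^\lor$, where $F^x_{u^*}$ is the result of substituting $u^*$ for all free occurrences of $x$ in $F$. First-order $\mathbf{p}$-stable models (Ferraris, Lee, Lifschitz). Let $\mathbf{p}=(p_1,\dots,p_n)$ be a tuple of distinct predicate symbols (not including equality) and $\mathbf{u}=(u_1,\dots,u_n)$ a tuple of distinct predicate variables of the same arities. $\mathbf{u}\leq\mathbf{p}$ stands for $\bigwedge_i\forall\mathbf{x}(u_i(\mathbf{x})\rightarrow p_i(\mathbf{x}))$, and $\mathbf{u}<\mathbf{p}$ for $(\mathbf{u}\leq\mathbf{p})\land\neg(\mathbf{p}\leq\mathbf{u})$. $F^*(\mathbf{u})$ is defined recursively: $p_i(\mathbf{t})^*=u_i(\mathbf{t})$; $F^*=F$ for any other atomic formula $F$ (including $\bot$ and equalities); $(F\land G)^*=F^*\land G^*$; $(F\lor G)^*=F^*\lor G^*$; $(F\rightarrow G)^*=(F^*\rightarrow G^*)\land(F\rightarrow G)$; $(\forall xF)^*=\forall xF^*$; $(\exists xF)^*=\exists xF^*$. An interpretation $I$ of $\Sigma$ is a $\mathbf{p}$-stable model of a sentence $F$ if it satisfies the second-order sentence $F\land\neg\exists\mathbf{u}\,((\mathbf{u}<\mathbf{p})\land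 F^*(\mathbf{u}))$. -}

module Defs where

open import Axiom.ExcludedMiddle using (ExcludedMiddle)
open import Data.Bool.Base using (Bool; true; false; if_then_else_)
open import Data.Empty.Polymorphic using (⊥; ⊥-elim)
open import Data.Fin.Base using (Fin; zero; suc)
open import Data.Nat.Base using (ℕ; zero; suc; _≤_; _<_; _⊔_; z≤n; s≤s; s≤s⁻¹)
open import Data.Nat.Properties
  using (≤-refl; ≤-trans; ≤-reflexive; ≤-<-trans; <-≤-trans; ≰⇒>; _≤?_;
         m≤n⇒m≤1+n; m⊔n≤o⇒m≤o; m⊔n≤o⇒n≤o; ⊔-mono-≤; ⊔-lub; m≤m⊔n; m≤n⊔m)
open import Data.Product.Base using (_×_; _,_; ∃; proj₁; proj₂)
open import Data.Sum.Base using (_⊎_; inj₁; inj₂; [_,_])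
open import Data.Vec.Base using (Vec; []; _∷_; lookup)
open import Level using (Level; Lift; lift; lower) renaming (suc to lsuc)
open import Relation.Binary.PropositionalEquality
  using (_≡_; refl; cong; cong₂; subst)
open import Relation.Nullary using (¬_; yes; no; contradiction)
open import Relation.Nullary.Decidable using (⌊_⌋)
open import Relation.Unary using (Pred; _∈_; _⊆_; _∖_; _≐_)

private
  variable
    ℓ : Level
    m n : ℕ

-- A set 𝓗 of formulas is given as a family indexed by a type J; repetitions
-- are harmless.  A pre-formula may be nested to unbounded depth, so it need
-- not have a rank in ℕ; those that do are the infinitary formulas below.

infixr 6 _⟶_

data PreFormula (A : Set ℓ) : Set (lsuc ℓ) where
  atom : A → PreFormula A
  ⋀ ⋁  : {J : Set ℓ} → (J → PreFormula A) → PreFormula A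
  _⟶_  : PreFormula A → PreFormula A → PreFormula A

module _ {A : Set ℓ} where

  ⊤∞ ⊥∞ : PreFormula A
  ⊤∞ = ⋀ {J = ⊥} ⊥-elim
  ⊥∞ = ⋁ {J = ⊥} ⊥-elim

  pair : PreFormula A → PreFormula A → Lift ℓ Bool → PreFormula A
  pair F G b = if lower b then F else G

  _∧∞_ _∨∞_ : PreFormula A → PreFormula A → PreFormula A
  F ∧∞ G = ⋀ (pair F G)
  F ∨∞ G = ⋁ (pair F G)

IsLeastAbove : {J : Set ℓ} → (J → ℕ) → ℕ → Set ℓ
IsLeastAbove k r = (∀ j → k j < r) × (∀ s → (∀ j → k j < s) → r ≤ s)

data HasRank {A : Set ℓ} : PreFormula A → ℕ → Set (lsuc ℓ) where
  atom : ∀ a → HasRank (atom a) 0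
  ⋀    : ∀ {J : Set ℓ} {𝓗 : J → PreFormula A} (k : J → ℕ) {r} →
         (∀ j → HasRank (𝓗 j) (k j)) → IsLeastAbove k r → HasRank (⋀ 𝓗) r
  ⋁    : ∀ {J : Set ℓ} {𝓗 : J → PreFormula A} (k : J → ℕ) {r} →
         (∀ j → HasRank (𝓗 j) (k j)) → IsLeastAbove k r → HasRank (⋁ 𝓗) r
  _⟶_  : ∀ {F G r s} → HasRank F r → HasRank G s → HasRank (F ⟶ G) (suc (r ⊔ s))

record InfFormula (A : Set ℓ) : Set (lsuc ℓ) where
  constructor formula
  field
    pre     : PreFormula A
    rank    : ℕ
    hasRank : HasRank pre rank

open InfFormula public

infix 4 _⊨ᵖ_ _⊨_ _≤[_]_

_⊨ᵖ_ : {A : Set ℓ} → Pred A ℓ → PreFormula A → Set ℓ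
I ⊨ᵖ atom a  = a ∈ I
I ⊨ᵖ ⋀ 𝓗     = ∀ j → I ⊨ᵖ 𝓗 j
I ⊨ᵖ ⋁ 𝓗     = ∃ λ j → I ⊨ᵖ 𝓗 j
I ⊨ᵖ (F ⟶ G) = (¬ (I ⊨ᵖ F)) ⊎ (I ⊨ᵖ G)

_⊨_ : {A : Set ℓ} → Pred A ℓ → InfFormula A → Set ℓ
I ⊨ F = I ⊨ᵖ pre F

_≤[_]_ : {A : Set ℓ} → Pred A ℓ → Pred A ℓ → Pred A ℓ → Set ℓ
I ≤[ 𝓐 ] J = (I ⊆ J) × ((J ∖ I) ⊆ 𝓐)

empty-rank : {k : ⊥ {ℓ} → ℕ} → IsLeastAbove k 0
empty-rank = (λ ()) , λ _ _ → z≤n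

⊤-rank : {A : Set ℓ} → HasRank (⊤∞ {A = A}) 0
⊤-rank = ⋀ ⊥-elim (λ ()) empty-rank

⊥-rank : {A : Set ℓ} → HasRank (⊥∞ {A = A}) 0
⊥-rank = ⋁ ⊥-elim (λ ()) empty-rank

pair-ranks : ℕ → ℕ → Lift ℓ Bool → ℕ
pair-ranks r s b = if lower b then r else s

pair-leastAbove : ∀ r s → IsLeastAbove (pair-ranks {ℓ} r s) (suc (r ⊔ s))
pair-leastAbove r s =
  (λ { (lift true) → s≤s (m≤m⊔n r s) ; (lift false) → s≤s (m≤n⊔m r s) }) ,
  λ { (suc t) b → s≤s (⊔-lub (s≤s⁻¹ (b (lift true))) (s≤s⁻¹ (b (lift false))))
    ; zero b → contradiction (b (lift true)) λ () }

pair-rank : {A : Set ℓ} {F G : PreFormula A} {r s : ℕ} → HasRank F r → HasRank G s →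
            ∀ b → HasRank (pair F G b) (pair-ranks {ℓ} r s b)
pair-rank f g (lift true)  = f
pair-rank f g (lift false) = g

const-leastAbove : {J : Set ℓ} → J → ∀ r → IsLeastAbove {J = J} (λ _ → r) (suc r)
const-leastAbove j r = (λ _ → ≤-refl) , λ _ b → b j

-- The reduct is defined by cases on membership and satisfaction, which are
-- undecidable in general; hence the explicit assumption of excluded middle.

module _ (em : ExcludedMiddle ℓ) {A : Set ℓ} where

  reductᵖ : Pred A ℓ → PreFormula A → PreFormula A
  reductᵖ I (atom a) = if ⌊ em {P = a ∈ I} ⌋ then atom a else ⊥∞
  reductᵖ I (⋀ 𝓗)    = ⋀ λ j → reductᵖ I (𝓗 j)
  reductᵖ I (⋁ 𝓗)    = ⋁ λ j → reductᵖ I (𝓗 j)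
  reductᵖ I (G ⟶ H)  =
    if ⌊ em {P = I ⊨ᵖ (G ⟶ H)} ⌋ then reductᵖ I G ⟶ reductᵖ I H else ⊥∞

  leastAbove : {J : Set ℓ} (k : J → ℕ) (r : ℕ) → (∀ j → k j < r) →
               ∃ λ s → s ≤ r × IsLeastAbove k s
  leastAbove k zero    b = 0 , z≤n , b , λ _ _ → z≤n
  leastAbove k (suc r) b with em {P = ∀ j → k j < r}
  ... | yes b′ = let s , s≤r , l = leastAbove k r b′ in s , m≤n⇒m≤1+n s≤r , l
  ... | no ¬b  = suc r , ≤-refl , b , least
    where
    least : ∀ s → (∀ j → k j < s) → suc r ≤ s
    least s c with suc r ≤? s
    ... | yes p = p
    ... | no ¬p with ≰⇒> ¬p
    ...   | s≤s s≤r = contradiction (λ j → <-≤-trans (c j) s≤r) ¬b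

  reduct-rank : ∀ I {F r} → HasRank F r → ∃ λ s → s ≤ r × HasRank (reductᵖ I F) s
  reduct-rank I (atom a) with em {P = a ∈ I}
  ... | yes _ = 0 , z≤n , atom a
  ... | no  _ = 0 , z≤n , ⊥-rank
  reduct-rank I (⋀ k h (b , _)) =
    let ih = λ j → reduct-rank I (h j)
        s , s≤r , l = leastAbove (λ j → proj₁ (ih j)) _
                        (λ j → ≤-<-trans (proj₁ (proj₂ (ih j))) (b j))
    in s , s≤r , ⋀ _ (λ j → proj₂ (proj₂ (ih j))) l
  reduct-rank I (⋁ k h (b , _)) =
    let ih = λ j → reduct-rank I (h j)
        s , s≤r , l = leastAbove (λ j → proj₁ (ih j)) _
                        (λ j → ≤-<-trans (proj₁ (proj₂ (ih j))) (b j))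
    in s , s≤r , ⋁ _ (λ j → proj₂ (proj₂ (ih j))) l
  reduct-rank I (_⟶_ {F} {G} f g) with em {P = I ⊨ᵖ (F ⟶ G)}
  ... | no  _ = 0 , z≤n , ⊥-rank
  ... | yes _ =
    let _ , p , f′ = reduct-rank I f
        _ , q , g′ = reduct-rank I g
    in _ , s≤s (⊔-mono-≤ p q) , f′ ⟶ g′

  reduct : Pred A ℓ → InfFormula A → InfFormula A
  reduct I (formula F r h) =
    let s , _ , h′ = reduct-rank I h in formula (reductᵖ I F) s h′

  IsStableModel : Pred A ℓ → Pred A ℓ → InfFormula A → Set (lsuc ℓ)
  IsStableModel 𝓐 I F =
    I ⊨ reduct I F × (∀ J → J ⊨ reduct I F → J ≤[ 𝓐 ] I → J ≐ I)

record Symbols (ℓ : Level) : Set (lsuc ℓ) where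
  constructor symbols
  field
    Sym   : Set ℓ
    arity : Sym → ℕ

open Symbols public

_⊕_ : Symbols ℓ → Symbols ℓ → Symbols ℓ
Φ ⊕ Ψ = symbols (Sym Φ ⊎ Sym Ψ) [ arity Φ , arity Ψ ]

record Signature (ℓ : Level) : Set (lsuc ℓ) where
  constructor signature
  field
    function  : Symbols ℓ
    predicate : Symbols ℓ

open Signature public

-- Variables are de Bruijn indices: Term Φ n and Formula Σ n have their free
-- variables among 0, …, n - 1.

data Term (Φ : Symbols ℓ) (n : ℕ) : Set ℓ where
  var : Fin n → Term Φ n
  app : (f : Sym Φ) → Vec (Term Φ n) (arity Φ f) → Term Φ n

infix  8 _≈_
infixr 7 _∧_
infixr 6 _∨_
infixr 5 _⇒_

data Formula (Σ : Signature ℓ) (n : ℕ) : Set ℓ where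
  ⊥′          : Formula Σ n
  pred        : (q : Sym (predicate Σ)) →
                Vec (Term (function Σ) n) (arity (predicate Σ) q) → Formula Σ n
  _≈_         : Term (function Σ) n → Term (function Σ) n → Formula Σ n
  _∧_ _∨_ _⇒_ : Formula Σ n → Formula Σ n → Formula Σ n
  all ex      : Formula Σ (suc n) → Formula Σ n

Sentence : Signature ℓ → Set ℓ
Sentence Σ = Formula Σ 0

module _ {Φ : Symbols ℓ} where

  mutual
    renameTerm : (Fin m → Fin n) → Term Φ m → Term Φ n
    renameTerm ρ (var i)    = var (ρ i)
    renameTerm ρ (app f ts) = app f (renameTerms ρ ts)

    renameTerms : ∀ {k} → (Fin m → Fin n) → Vec (Term Φ m) k → Vec (Term Φ n) k
    renameTerms ρ []       = []
    renameTerms ρ (t ∷ ts) = renameTerm ρ t ∷ renameTerms ρ ts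

  mutual
    substTerm : (Fin m → Term Φ n) → Term Φ m → Term Φ n
    substTerm τ (var i)    = τ i
    substTerm τ (app f ts) = app f (substTerms τ ts)

    substTerms : ∀ {k} → (Fin m → Term Φ n) → Vec (Term Φ m) k → Vec (Term Φ n) k
    substTerms τ []       = []
    substTerms τ (t ∷ ts) = substTerm τ t ∷ substTerms τ ts

  liftSubst : (Fin m → Term Φ n) → Fin (suc m) → Term Φ (suc n)
  liftSubst τ zero    = var zero
  liftSubst τ (suc i) = renameTerm suc (τ i)

  instantiate : Term Φ n → Fin (suc n) → Term Φ n
  instantiate t zero    = t
  instantiate t (suc i) = var i

substFormula : {Σ : Signature ℓ} → (Fin m → Term (function Σ) n) → Formula Σ m → Formula Σ n
substFormula τ ⊥′          = ⊥′
substFormula τ (pred q ts) = pred q (substTerms τ ts)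
substFormula τ (s ≈ t)     = substTerm τ s ≈ substTerm τ t
substFormula τ (F ∧ G)     = substFormula τ F ∧ substFormula τ G
substFormula τ (F ∨ G)     = substFormula τ F ∨ substFormula τ G
substFormula τ (F ⇒ G)     = substFormula τ F ⇒ substFormula τ G
substFormula τ (all F)     = all (substFormula (liftSubst τ) F)
substFormula τ (ex F)      = ex (substFormula (liftSubst τ) F)

_[_] : {Σ : Signature ℓ} → Formula Σ (suc n) → Term (function Σ) n → Formula Σ n
F [ t ] = substFormula (instantiate t) F

mutual
  embedTerm : {Φ Ψ : Symbols ℓ} → Term Φ n → Term (Φ ⊕ Ψ) n
  embedTerm (var i)    = var i
  embedTerm (app f ts) = app (inj₁ f) (embedTerms ts)

  embedTerms : ∀ {Φ Ψ : Symbols ℓ} {k} → Vec (Term Φ n) k → Vec (Term (Φ ⊕ Ψ) n) k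
  embedTerms []       = []
  embedTerms (t ∷ ts) = embedTerm t ∷ embedTerms ts

addFunctions addPredicates : Signature ℓ → Symbols ℓ → Signature ℓ
addFunctions  Σ Ψ = signature (function Σ ⊕ Ψ) (predicate Σ)
addPredicates Σ Ψ = signature (function Σ) (predicate Σ ⊕ Ψ)

module _ {Σ : Signature ℓ} {Ψ : Symbols ℓ} where

  embedᶠ : Formula Σ n → Formula (addFunctions Σ Ψ) n
  embedᶠ ⊥′          = ⊥′
  embedᶠ (pred q ts) = pred q (embedTerms ts)
  embedᶠ (s ≈ t)     = embedTerm s ≈ embedTerm t
  embedᶠ (F ∧ G)     = embedᶠ F ∧ embedᶠ G
  embedᶠ (F ∨ G)     = embedᶠ F ∨ embedᶠ G
  embedᶠ (F ⇒ G)     = embedᶠ F ⇒ embedᶠ G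
  embedᶠ (all F)     = all (embedᶠ F)
  embedᶠ (ex F)      = ex (embedᶠ F)

  embedᵖ : Formula Σ n → Formula (addPredicates Σ Ψ) n
  embedᵖ ⊥′          = ⊥′
  embedᵖ (pred q ts) = pred (inj₁ q) ts
  embedᵖ (s ≈ t)     = s ≈ t
  embedᵖ (F ∧ G)     = embedᵖ F ∧ embedᵖ G
  embedᵖ (F ∨ G)     = embedᵖ F ∨ embedᵖ G
  embedᵖ (F ⇒ G)     = embedᵖ F ⇒ embedᵖ G
  embedᵖ (all F)     = all (embedᵖ F)
  embedᵖ (ex F)      = ex (embedᵖ F)

record Interpretation (Σ : Signature ℓ) : Set (lsuc ℓ) where
  field
    Domain    : Set ℓ
    inhabited : Domain
    fun       : (f : Sym (function Σ)) → Vec Domain (arity (function Σ) f) → Domain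
    rel       : (q : Sym (predicate Σ)) → Pred (Vec Domain (arity (predicate Σ) q)) ℓ

open Interpretation public

module _ {Σ : Signature ℓ} (I : Interpretation Σ) where

  mutual
    eval : Vec (Domain I) n → Term (function Σ) n → Domain I
    eval ρ (var i)    = lookup ρ i
    eval ρ (app f ts) = fun I f (evals ρ ts)

    evals : ∀ {k} → Vec (Domain I) n → Vec (Term (function Σ) n) k → Vec (Domain I) k
    evals ρ []       = []
    evals ρ (t ∷ ts) = eval ρ t ∷ evals ρ ts

  Sat : Vec (Domain I) n → Formula Σ n → Set ℓ
  Sat ρ ⊥′          = ⊥
  Sat ρ (pred q ts) = rel I q (evals ρ ts)
  Sat ρ (s ≈ t)     = eval ρ s ≡ eval ρ t
  Sat ρ (F ∧ G)     = Sat ρ F × Sat ρ G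
  Sat ρ (F ∨ G)     = Sat ρ F ⊎ Sat ρ G
  Sat ρ (F ⇒ G)     = Sat ρ F → Sat ρ G
  Sat ρ (all F)     = ∀ u → Sat (u ∷ ρ) F
  Sat ρ (ex F)      = ∃ λ u → Sat (u ∷ ρ) F

  Satisfies : Sentence Σ → Set ℓ
  Satisfies = Sat []

-- Predicate variables u₁, …, uₙ matching the arities of p₁, …, pₙ are treated
-- as additional predicate symbols.

module _ {Σ : Signature ℓ} (p : Fin n → Sym (predicate Σ)) where

  predVars : Symbols ℓ
  predVars = symbols (Lift ℓ (Fin n)) λ i → arity (predicate Σ) (p (lower i))

  withPredVars : Signature ℓ
  withPredVars = addPredicates Σ predVars

  module _ (I : Interpretation Σ) where

    PredValues : Set (lsuc ℓ)
    PredValues = (i : Fin n) → Pred (Vec (Domain I) (arity (predicate Σ) (p i))) ℓ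

    assign : PredValues → Interpretation withPredVars
    assign u .Domain            = Domain I
    assign u .inhabited         = inhabited I
    assign u .fun               = fun I
    assign u .rel (inj₁ q)      = rel I q
    assign u .rel (inj₂ (lift i)) = u i

    _≤ᵖ_ : PredValues → PredValues → Set ℓ
    u ≤ᵖ v = ∀ i xs → u i xs → v i xs

    _<ᵖ_ : PredValues → PredValues → Set ℓ
    u <ᵖ v = (u ≤ᵖ v) × ¬ (v ≤ᵖ u)

    values : PredValues
    values i = rel I (p i)

  module _ (em : ExcludedMiddle ℓ) where

    star : ∀ {k} → Formula Σ k → Formula withPredVars k
    star ⊥′          = ⊥′
    star (pred q ts) with em {P = ∃ λ (i : Lift ℓ (Fin n)) → p (lower i) ≡ q}
    ... | yes (i , refl) = pred (inj₂ i) ts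
    ... | no _           = pred (inj₁ q) ts
    star (s ≈ t)     = s ≈ t
    star (F ∧ G)     = star F ∧ star G
    star (F ∨ G)     = star F ∨ star G
    star (F ⇒ G)     = (star F ⇒ star G) ∧ (embedᵖ F ⇒ embedᵖ G)
    star (all F)     = all (star F)
    star (ex F)      = ex (star F)

    IsPStableModel : Interpretation Σ → Sentence Σ → Set (lsuc ℓ)
    IsPStableModel I F =
      Satisfies I F ×
      ¬ (∃ λ (u : PredValues I) → _<ᵖ_ I u (values I) × Satisfies (assign I u) (star F))

-- This is also the rank of the grounding; see ground-rank.

height : {Σ : Signature ℓ} → Formula Σ n → ℕ
height ⊥′         = 0
height (pred _ _) = 0
height (_ ≈ _)    = 0
height (F ∧ G)    = suc (height F ⊔ height G)
height (F ∨ G)    = suc (height F ⊔ height G)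
height (F ⇒ G)    = suc (height F ⊔ height G)
height (all F)    = suc (height F)
height (ex F)     = suc (height F)

height-subst : {Σ : Signature ℓ} (τ : Fin m → Term (function Σ) n) (F : Formula Σ m) →
               height (substFormula τ F) ≡ height F
height-subst τ ⊥′         = refl
height-subst τ (pred _ _) = refl
height-subst τ (_ ≈ _)    = refl
height-subst τ (F ∧ G)    = cong₂ (λ a b → suc (a ⊔ b)) (height-subst τ F) (height-subst τ G)
height-subst τ (F ∨ G)    = cong₂ (λ a b → suc (a ⊔ b)) (height-subst τ F) (height-subst τ G)
height-subst τ (F ⇒ G)    = cong₂ (λ a b → suc (a ⊔ b)) (height-subst τ F) (height-subst τ G)
height-subst τ (all F)    = cong suc (height-subst (liftSubst τ) F)
height-subst τ (ex F)     = cong suc (height-subst (liftSubst τ) F)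

module _ {Σ : Signature ℓ} (I : Interpretation Σ) where

  names : Symbols ℓ
  names = symbols (Domain I) λ _ → 0

  withNames : Signature ℓ
  withNames = addFunctions Σ names

  name : Domain I → Term (function withNames) n
  name u = app (inj₂ u) []

  interpretNames : Interpretation withNames
  interpretNames .Domain        = Domain I
  interpretNames .inhabited     = inhabited I
  interpretNames .fun (inj₁ f)  = fun I f
  interpretNames .fun (inj₂ u) _ = u
  interpretNames .rel           = rel I

  -- The atomic sentence q(u₁*, …, uₖ*) is represented by q and u₁, …, uₖ.
  record GroundAtom : Set ℓ where
    constructor _⟨_⟩
    field
      symbol : Sym (predicate Σ)
      args   : Vec (Domain I) (arity (predicate Σ) symbol)

  trueAtoms : Pred GroundAtom ℓ
  trueAtoms (q ⟨ us ⟩) = rel I q us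

  atomsOf : (Fin n → Sym (predicate Σ)) → Pred GroundAtom ℓ
  atomsOf {n} p (q ⟨ _ ⟩) = ∃ λ (i : Lift ℓ (Fin n)) → p (lower i) ≡ q

  value : Term (function withNames) 0 → Domain I
  value = eval interpretNames []

  values* : ∀ {k} → Vec (Term (function withNames) 0) k → Vec (Domain I) k
  values* = evals interpretNames []

  module _ (em : ExcludedMiddle ℓ) where

    -- The instance F [ name u ] is not a subterm of all F, so the recursion
    -- is on a bound h for the height of the sentence.
    ground : (h : ℕ) (F : Sentence withNames) → height F ≤ h → PreFormula GroundAtom
    ground h ⊥′          _ = ⊥∞
    ground h (pred q ts) _ = atom (q ⟨ values* ts ⟩)
    ground h (s ≈ t)     _ = if ⌊ em {P = value s ≡ value t} ⌋ then ⊤∞ else ⊥∞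
    ground (suc h) (F ∧ G) (s≤s b) =
      ground h F (m⊔n≤o⇒m≤o _ _ b) ∧∞ ground h G (m⊔n≤o⇒n≤o _ _ b)
    ground (suc h) (F ∨ G) (s≤s b) =
      ground h F (m⊔n≤o⇒m≤o _ _ b) ∨∞ ground h G (m⊔n≤o⇒n≤o _ _ b)
    ground (suc h) (F ⇒ G) (s≤s b) =
      ground h F (m⊔n≤o⇒m≤o _ _ b) ⟶ ground h G (m⊔n≤o⇒n≤o _ _ b)
    ground (suc h) (all F) (s≤s b) =
      ⋀ λ u → ground h (F [ name u ]) (≤-trans (≤-reflexive (height-subst _ F)) b)
    ground (suc h) (ex F) (s≤s b) =
      ⋁ λ u → ground h (F [ name u ]) (≤-trans (≤-reflexive (height-subst _ F)) b)

    ground-rank : ∀ h F (b : height F ≤ h) → HasRank (ground h F b) (height F)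
    ground-rank h ⊥′ b = ⊥-rank
    ground-rank h (pred q ts) b = atom _
    ground-rank h (s ≈ t) b with em {P = value s ≡ value t}
    ... | yes _ = ⊤-rank
    ... | no  _ = ⊥-rank
    ground-rank (suc h) (F ∧ G) (s≤s b) =
      ⋀ _ (pair-rank (ground-rank h F _) (ground-rank h G _)) (pair-leastAbove _ _)
    ground-rank (suc h) (F ∨ G) (s≤s b) =
      ⋁ _ (pair-rank (ground-rank h F _) (ground-rank h G _)) (pair-leastAbove _ _)
    ground-rank (suc h) (F ⇒ G) (s≤s b) = ground-rank h F _ ⟶ ground-rank h G _
    ground-rank (suc h) (all F) (s≤s b) =
      ⋀ (λ _ → height F)
        (λ u → subst (HasRank _) (height-subst _ F) (ground-rank h (F [ name u ]) _))
        (const-leastAbove (inhabited I) _)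
    ground-rank (suc h) (ex F) (s≤s b) =
      ⋁ (λ _ → height F)
        (λ u → subst (HasRank _) (height-subst _ F) (ground-rank h (F [ name u ]) _))
        (const-leastAbove (inhabited I) _)

    gr : Sentence withNames → InfFormula GroundAtom
    gr F = formula (ground (height F) F ≤-refl) (height F) (ground-rank (height F) F ≤-refl)

{-# OPTIONS --safe #-}
-- Grounding is first described by a relation between formulas with free
-- variables under an assignment and infinitary formulas; it is structural in
-- the first-order formula, so no name has to be substituted afterwards.  Along
-- this relation, F* under values u of the predicate variables corresponds to
-- satisfaction of the reduct by the set J of atoms that agrees with u on 𝐩 and
-- with I elsewhere, provided u ≤ 𝐩.  The theorem follows because u ↦ J maps the
-- tuples u < 𝐩 onto the sets J that lie strictly below Iʳ.
module Submission where

open import Axiom.ExcludedMiddle using (ExcludedMiddle)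
open import Data.Bool.Base using (true; false)
open import Data.Fin.Base using (Fin; zero; suc)
open import Data.Nat.Base using (ℕ; suc; _≤_; s≤s)
open import Data.Nat.Properties using (≤-refl)
open import Data.Product.Base using (_×_; _,_; ∃; proj₁)
import Data.Sum.Base as Sum
open import Data.Sum.Base using (_⊎_; inj₁; inj₂)
open import Data.Vec.Base using (Vec; []; _∷_; lookup)
open import Function.Base using (_∘_)
open import Function.Bundles using (_⇔_; mk⇔; module Equivalence)
open import Function.Definitions using (Injective)
open import Level using (Level; Lift; lift; lower) renaming (suc to lsuc)
open import Relation.Binary.PropositionalEquality
  using (_≡_; refl; sym; trans; cong; cong₂; subst)
open import Relation.Nullary using (¬_; yes; no; contradiction)
open import Relation.Unary using (Pred; _∈_; _⊆_; _≐_)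
open import Defs

open Equivalence using (to; from)

private
  variable
    ℓ : Level
    k m n : ℕ

-- Composition of substitutions in terms and formulas.

module _ {Φ : Symbols ℓ} where

  consSubst : Term Φ n → (Fin m → Term Φ n) → Fin (suc m) → Term Φ n
  consSubst t τ zero    = t
  consSubst t τ (suc i) = τ i

  mutual
    substTerm-var : {τ : Fin n → Term Φ n} → (∀ i → τ i ≡ var i) →
                    ∀ t → substTerm τ t ≡ t
    substTerm-var e (var i)    = e i
    substTerm-var e (app f ts) = cong (app f) (substTerms-var e ts)

    substTerms-var : {τ : Fin n → Term Φ n} → (∀ i → τ i ≡ var i) →
                     (ts : Vec (Term Φ n) k) → substTerms τ ts ≡ ts
    substTerms-var e []       = refl
    substTerms-var e (t ∷ ts) = cong₂ _∷_ (substTerm-var e t) (substTerms-var e ts)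

  mutual
    -- The composite enters as any `υ` that agrees with it pointwise. In this form the hypothesis
    -- can be lifted under a binder without function extensionality.
    substTerm-∘ : ∀ {l} {σ : Fin m → Term Φ n} {τ : Fin l → Term Φ m} {υ : Fin l → Term Φ n} →
                  (∀ i → substTerm σ (τ i) ≡ υ i) →
                  ∀ t → substTerm σ (substTerm τ t) ≡ substTerm υ t
    substTerm-∘ e (var i)    = e i
    substTerm-∘ e (app f ts) = cong (app f) (substTerms-∘ e ts)

    substTerms-∘ : ∀ {l} {σ : Fin m → Term Φ n} {τ : Fin l → Term Φ m} {υ : Fin l → Term Φ n} →
                   (∀ i → substTerm σ (τ i) ≡ υ i) →
                   (ts : Vec (Term Φ l) k) → substTerms σ (substTerms τ ts) ≡ substTerms υ ts
    substTerms-∘ e []       = refl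
    substTerms-∘ e (t ∷ ts) = cong₂ _∷_ (substTerm-∘ e t) (substTerms-∘ e ts)

  mutual
    substTerm-liftSubst-rename : (σ : Fin m → Term Φ n) → ∀ t →
      substTerm (liftSubst σ) (renameTerm suc t) ≡ renameTerm suc (substTerm σ t)
    substTerm-liftSubst-rename σ (var i)    = refl
    substTerm-liftSubst-rename σ (app f ts) = cong (app f) (substTerms-liftSubst-rename σ ts)

    substTerms-liftSubst-rename : (σ : Fin m → Term Φ n) (ts : Vec (Term Φ m) k) →
      substTerms (liftSubst σ) (renameTerms suc ts) ≡ renameTerms suc (substTerms σ ts)
    substTerms-liftSubst-rename σ []       = refl
    substTerms-liftSubst-rename σ (t ∷ ts) =
      cong₂ _∷_ (substTerm-liftSubst-rename σ t) (substTerms-liftSubst-rename σ ts)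

  mutual
    substTerm-instantiate-rename : (s : Term Φ n) → ∀ t →
      substTerm (instantiate s) (renameTerm suc t) ≡ t
    substTerm-instantiate-rename s (var i)    = refl
    substTerm-instantiate-rename s (app f ts) = cong (app f) (substTerms-instantiate-rename s ts)

    substTerms-instantiate-rename : (s : Term Φ n) (ts : Vec (Term Φ n) k) →
      substTerms (instantiate s) (renameTerms suc ts) ≡ ts
    substTerms-instantiate-rename s []       = refl
    substTerms-instantiate-rename s (t ∷ ts) =
      cong₂ _∷_ (substTerm-instantiate-rename s t) (substTerms-instantiate-rename s ts)

  liftSubst-var : {τ : Fin n → Term Φ n} → (∀ i → τ i ≡ var i) → ∀ i → liftSubst τ i ≡ var i
  liftSubst-var e zero    = refl
  liftSubst-var e (suc i) = cong (renameTerm suc) (e i)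

  liftSubst-∘ : ∀ {l} {σ : Fin m → Term Φ n} {τ : Fin l → Term Φ m} {υ : Fin l → Term Φ n} →
                (∀ i → substTerm σ (τ i) ≡ υ i) →
                ∀ i → substTerm (liftSubst σ) (liftSubst τ i) ≡ liftSubst υ i
  liftSubst-∘             e zero    = refl
  liftSubst-∘ {σ = σ} {τ} e (suc i) =
    trans (substTerm-liftSubst-rename σ (τ i)) (cong (renameTerm suc) (e i))

module _ {Σ : Signature ℓ} where

  private
    T : ℕ → Set ℓ
    T = Term (function Σ)

  substFormula-var : {τ : Fin n → T n} → (∀ i → τ i ≡ var i) →
                     (F : Formula Σ n) → substFormula τ F ≡ F
  substFormula-var e ⊥′          = refl
  substFormula-var e (pred q ts) = cong (pred q) (substTerms-var e ts)
  substFormula-var e (s ≈ t)     = cong₂ _≈_ (substTerm-var e s) (substTerm-var e t)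
  substFormula-var e (F ∧ G)     = cong₂ _∧_ (substFormula-var e F) (substFormula-var e G)
  substFormula-var e (F ∨ G)     = cong₂ _∨_ (substFormula-var e F) (substFormula-var e G)
  substFormula-var e (F ⇒ G)     = cong₂ _⇒_ (substFormula-var e F) (substFormula-var e G)
  substFormula-var e (all F)     = cong all (substFormula-var (liftSubst-var e) F)
  substFormula-var e (ex F)      = cong ex (substFormula-var (liftSubst-var e) F)

  substFormula-∘ : {σ : Fin m → T n} {τ : Fin k → T m} {υ : Fin k → T n} →
                   (∀ i → substTerm σ (τ i) ≡ υ i) →
                   (F : Formula Σ k) → substFormula σ (substFormula τ F) ≡ substFormula υ F
  substFormula-∘ e ⊥′          = refl
  substFormula-∘ e (pred q ts) = cong (pred q) (substTerms-∘ e ts)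
  substFormula-∘ e (s ≈ t)     = cong₂ _≈_ (substTerm-∘ e s) (substTerm-∘ e t)
  substFormula-∘ e (F ∧ G)     = cong₂ _∧_ (substFormula-∘ e F) (substFormula-∘ e G)
  substFormula-∘ e (F ∨ G)     = cong₂ _∨_ (substFormula-∘ e F) (substFormula-∘ e G)
  substFormula-∘ e (F ⇒ G)     = cong₂ _⇒_ (substFormula-∘ e F) (substFormula-∘ e G)
  substFormula-∘ e (all F)     = cong all (substFormula-∘ (liftSubst-∘ e) F)
  substFormula-∘ e (ex F)      = cong ex (substFormula-∘ (liftSubst-∘ e) F)

  -- Grounding a quantifier instantiates a body that already carries a lifted substitution. Merging
  -- the two into one substitution lets the induction go to the body itself instead of to its
  -- instance.
  instantiate-liftSubst : (t : T n) (τ : Fin m → T n) (F : Formula Σ (suc m)) →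
                          substFormula (liftSubst τ) F [ t ] ≡ substFormula (consSubst t τ) F
  instantiate-liftSubst t τ = substFormula-∘ λ
    { zero    → refl
    ; (suc i) → substTerm-instantiate-rename t (τ i) }

-- Classical implication, and the reduct at its own interpretation.

module _ (em : ExcludedMiddle ℓ) where

  -- Bridges the two readings of implication: a disjunction in infinitary satisfaction, a function
  -- in first-order satisfaction. Excluded middle serves the passage from functions to sums.
  ¬⊎-⇔-→ : {A B : Set ℓ} → ((¬ A) ⊎ B) ⇔ (A → B)
  ¬⊎-⇔-→ {A} {B} = mk⇔ fromSum toSum
    where
    fromSum : (¬ A) ⊎ B → A → B
    fromSum (inj₁ ¬a) a = contradiction a ¬a
    fromSum (inj₂ b)  _ = b

    toSum : (A → B) → (¬ A) ⊎ B
    toSum f with em {P = A}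
    ... | yes a = inj₂ (f a)
    ... | no ¬a = inj₁ ¬a

  -- The reduct replaces by `⊥∞` only atoms and implications that are false in `I`, so truth in `I`
  -- itself is unaffected.
  ⊨ᵖ-reduct-self : {A : Set ℓ} (I : Pred A ℓ) (P : PreFormula A) →
                   (I ⊨ᵖ reductᵖ em I P) ⇔ (I ⊨ᵖ P)
  ⊨ᵖ-reduct-self I (atom a) with em {P = a ∈ I}
  ... | yes _ = mk⇔ (λ x → x) (λ x → x)
  ... | no ¬a = mk⇔ (λ ()) (λ a → contradiction a ¬a)
  ⊨ᵖ-reduct-self I (⋀ 𝓗) =
    mk⇔ (λ f j → to (⊨ᵖ-reduct-self I (𝓗 j)) (f j))
        (λ f j → from (⊨ᵖ-reduct-self I (𝓗 j)) (f j))
  ⊨ᵖ-reduct-self I (⋁ 𝓗) =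
    mk⇔ (λ (j , x) → j , to (⊨ᵖ-reduct-self I (𝓗 j)) x)
        (λ (j , x) → j , from (⊨ᵖ-reduct-self I (𝓗 j)) x)
  ⊨ᵖ-reduct-self I (P ⟶ Q) with em {P = I ⊨ᵖ (P ⟶ Q)}
  ... | no ¬x = mk⇔ (λ ()) (λ x → contradiction x ¬x)
  ... | yes x = mk⇔ (λ _ → x) λ x → from ¬⊎-⇔-→
    (from (⊨ᵖ-reduct-self I Q) ∘ to ¬⊎-⇔-→ x ∘ to (⊨ᵖ-reduct-self I P))

-- Grounding as a relation, and its agreement with `gr`.

module _ {Σ : Signature ℓ} (I : Interpretation Σ) where

  -- The two constructors for equality record the outcome of the test made by `ground`, so
  -- inductions over the relation need neither that test nor the height bound.
  data IsGrounding : Vec (Domain I) k → Formula Σ k → PreFormula (GroundAtom I) → Set (lsuc ℓ) where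
    ⊥′    : {ρ : Vec (Domain I) k} → IsGrounding ρ ⊥′ ⊥∞
    pred  : ∀ {ρ : Vec (Domain I) k} {q ts} →
            IsGrounding ρ (pred q ts) (atom (q ⟨ evals I ρ ts ⟩))
    ≈-yes : ∀ {ρ : Vec (Domain I) k} {s t} → eval I ρ s ≡ eval I ρ t →
            IsGrounding ρ (s ≈ t) ⊤∞
    ≈-no  : ∀ {ρ : Vec (Domain I) k} {s t} → ¬ eval I ρ s ≡ eval I ρ t →
            IsGrounding ρ (s ≈ t) ⊥∞
    _∧_   : ∀ {ρ : Vec (Domain I) k} {F G P Q} →
            IsGrounding ρ F P → IsGrounding ρ G Q → IsGrounding ρ (F ∧ G) (P ∧∞ Q)
    _∨_   : ∀ {ρ : Vec (Domain I) k} {F G P Q} →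
            IsGrounding ρ F P → IsGrounding ρ G Q → IsGrounding ρ (F ∨ G) (P ∨∞ Q)
    _⇒_   : ∀ {ρ : Vec (Domain I) k} {F G P Q} →
            IsGrounding ρ F P → IsGrounding ρ G Q → IsGrounding ρ (F ⇒ G) (P ⟶ Q)
    all   : ∀ {ρ : Vec (Domain I) k} {F 𝓗} →
            (∀ u → IsGrounding (u ∷ ρ) F (𝓗 u)) → IsGrounding ρ (all F) (⋀ 𝓗)
    ex    : ∀ {ρ : Vec (Domain I) k} {F 𝓗} →
            (∀ u → IsGrounding (u ∷ ρ) F (𝓗 u)) → IsGrounding ρ (ex F) (⋁ 𝓗)

  private
    N : Signature ℓ
    N = withNames I

  module _ {τ : Fin k → Term (function N) 0} {ρ : Vec (Domain I) k}
           (e : ∀ i → value I (τ i) ≡ lookup ρ i) where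
    mutual
      value-subst-embed : ∀ t → value I (substTerm τ (embedTerm t)) ≡ eval I ρ t
      value-subst-embed (var i)    = e i
      value-subst-embed (app f ts) = cong (fun I f) (values*-subst-embed ts)

      values*-subst-embed : (ts : Vec (Term (function Σ) k) n) →
        values* I (substTerms τ (embedTerms ts)) ≡ evals I ρ ts
      values*-subst-embed []       = refl
      values*-subst-embed (t ∷ ts) = cong₂ _∷_ (value-subst-embed t) (values*-subst-embed ts)

  module _ (em : ExcludedMiddle ℓ) where

    -- The sentence is a variable `G` with an equation because under a quantifier the instance is
    -- only propositionally equal to a substituted body. Matching the equation with `refl` avoids
    -- transporting `ground` and its bound along it.
    ground-isGrounding : ∀ h (F : Formula Σ k) (τ : Fin k → Term (function N) 0)
      {ρ : Vec (Domain I) k} → (∀ i → value I (τ i) ≡ lookup ρ i) →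
      ∀ {G} → G ≡ substFormula τ (embedᶠ F) → (b : height G ≤ h) →
      IsGrounding ρ F (ground I em h G b)
    ground-isGrounding h ⊥′ τ e refl b = ⊥′
    ground-isGrounding h (pred q ts) τ e refl b =
      subst (λ us → IsGrounding _ (pred q ts) (atom (q ⟨ us ⟩)))
            (sym (values*-subst-embed e ts)) pred
    ground-isGrounding h (s ≈ t) τ {ρ} e refl b
      with em {P = value I (substTerm τ (embedTerm s)) ≡ value I (substTerm τ (embedTerm t))}
    ... | yes eq =
      ≈-yes (trans (sym (value-subst-embed e s)) (trans eq (value-subst-embed e t)))
    ... | no ¬eq =
      ≈-no λ eq → ¬eq (trans (value-subst-embed e s) (trans eq (sym (value-subst-embed e t))))
    ground-isGrounding (suc h) (F ∧ G) τ e refl (s≤s b) =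
      ground-isGrounding h F τ e refl _ ∧ ground-isGrounding h G τ e refl _
    ground-isGrounding (suc h) (F ∨ G) τ e refl (s≤s b) =
      ground-isGrounding h F τ e refl _ ∨ ground-isGrounding h G τ e refl _
    ground-isGrounding (suc h) (F ⇒ G) τ e refl (s≤s b) =
      ground-isGrounding h F τ e refl _ ⇒ ground-isGrounding h G τ e refl _
    ground-isGrounding (suc h) (all F) τ e refl (s≤s b) = all λ u →
      -- The name of `u` evaluates to `u` by definition, so the extended substitution agrees with
      -- `u ∷ ρ`.
      ground-isGrounding h F (consSubst (name I u) τ) (λ { zero → refl ; (suc i) → e i })
        (instantiate-liftSubst (name I u) τ (embedᶠ F)) _
    ground-isGrounding (suc h) (ex F) τ e refl (s≤s b) = ex λ u →
      ground-isGrounding h F (consSubst (name I u) τ) (λ { zero → refl ; (suc i) → e i })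
        (instantiate-liftSubst (name I u) τ (embedᶠ F)) _

    gr-isGrounding : (F : Sentence Σ) → IsGrounding [] F (pre (gr I em (embedᶠ F)))
    gr-isGrounding F =
      ground-isGrounding _ F var (λ ()) (sym (substFormula-var (λ _ → refl) (embedᶠ F))) ≤-refl

    -- Needed twice: for the requirement that `I` be a model at all, and for the conjunct `F ⇒ G`
    -- that `star` adds to an implication.
    Sat-⇔-⊨ᵖ : {ρ : Vec (Domain I) k} → ∀ {F P} → IsGrounding ρ F P →
               Sat I ρ F ⇔ (trueAtoms I ⊨ᵖ P)
    Sat-⇔-⊨ᵖ ⊥′         = mk⇔ (λ ()) (λ ())
    Sat-⇔-⊨ᵖ pred       = mk⇔ (λ x → x) (λ x → x)
    Sat-⇔-⊨ᵖ (≈-yes eq) = mk⇔ (λ _ ()) (λ _ → eq)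
    Sat-⇔-⊨ᵖ (≈-no ¬eq) = mk⇔ (λ eq → contradiction eq ¬eq) (λ ())
    Sat-⇔-⊨ᵖ (f ∧ g) =
      mk⇔ (λ { (x , y) (lift true)  → to (Sat-⇔-⊨ᵖ f) x
             ; (x , y) (lift false) → to (Sat-⇔-⊨ᵖ g) y })
          (λ x → from (Sat-⇔-⊨ᵖ f) (x (lift true)) , from (Sat-⇔-⊨ᵖ g) (x (lift false)))
    Sat-⇔-⊨ᵖ (f ∨ g) =
      mk⇔ (λ { (inj₁ x) → lift true  , to (Sat-⇔-⊨ᵖ f) x
             ; (inj₂ y) → lift false , to (Sat-⇔-⊨ᵖ g) y })
          (λ { (lift true  , x) → inj₁ (from (Sat-⇔-⊨ᵖ f) x)
             ; (lift false , y) → inj₂ (from (Sat-⇔-⊨ᵖ g) y) })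
    Sat-⇔-⊨ᵖ (f ⇒ g) =
      mk⇔ (λ x → from (¬⊎-⇔-→ em) (to (Sat-⇔-⊨ᵖ g) ∘ x ∘ from (Sat-⇔-⊨ᵖ f)))
          (λ x → from (Sat-⇔-⊨ᵖ g) ∘ to (¬⊎-⇔-→ em) x ∘ to (Sat-⇔-⊨ᵖ f))
    Sat-⇔-⊨ᵖ (all f) =
      mk⇔ (λ x u → to (Sat-⇔-⊨ᵖ (f u)) (x u)) (λ x u → from (Sat-⇔-⊨ᵖ (f u)) (x u))
    Sat-⇔-⊨ᵖ (ex f) =
      mk⇔ (λ (u , x) → u , to (Sat-⇔-⊨ᵖ (f u)) x) (λ (u , x) → u , from (Sat-⇔-⊨ᵖ (f u)) x)

-- Satisfaction of `star F` against satisfaction of the reduct.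

module _ {Σ : Signature ℓ} (p : Fin n → Sym (predicate Σ)) (I : Interpretation Σ)
         (u : PredValues p I) where

  private
    Iᵘ : Interpretation (withPredVars p)
    Iᵘ = assign p I u

  mutual
    eval-assign : (ρ : Vec (Domain I) k) → ∀ t → eval Iᵘ ρ t ≡ eval I ρ t
    eval-assign ρ (var i)    = refl
    eval-assign ρ (app f ts) = cong (fun I f) (evals-assign ρ ts)

    evals-assign : (ρ : Vec (Domain I) k) (ts : Vec (Term (function Σ) k) m) →
                   evals Iᵘ ρ ts ≡ evals I ρ ts
    evals-assign ρ []       = refl
    evals-assign ρ (t ∷ ts) = cong₂ _∷_ (eval-assign ρ t) (evals-assign ρ ts)

  Sat-≈-assign : (ρ : Vec (Domain I) k) → ∀ s t → Sat Iᵘ ρ (s ≈ t) ⇔ Sat I ρ (s ≈ t)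
  Sat-≈-assign ρ s t =
    mk⇔ (λ eq → trans (sym (eval-assign ρ s)) (trans eq (eval-assign ρ t)))
        (λ eq → trans (eval-assign ρ s) (trans eq (sym (eval-assign ρ t))))

  Sat-embedᵖ : (ρ : Vec (Domain I) k) (F : Formula Σ k) → Sat Iᵘ ρ (embedᵖ F) ⇔ Sat I ρ F
  Sat-embedᵖ ρ ⊥′ = mk⇔ (λ ()) (λ ())
  Sat-embedᵖ ρ (pred q ts) =
    mk⇔ (subst (rel I q) (evals-assign ρ ts)) (subst (rel I q) (sym (evals-assign ρ ts)))
  Sat-embedᵖ ρ (s ≈ t) = Sat-≈-assign ρ s t
  Sat-embedᵖ ρ (F ∧ G) =
    mk⇔ (λ (x , y) → to (Sat-embedᵖ ρ F) x , to (Sat-embedᵖ ρ G) y)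
        (λ (x , y) → from (Sat-embedᵖ ρ F) x , from (Sat-embedᵖ ρ G) y)
  Sat-embedᵖ ρ (F ∨ G) =
    mk⇔ (Sum.map (to (Sat-embedᵖ ρ F)) (to (Sat-embedᵖ ρ G)))
        (Sum.map (from (Sat-embedᵖ ρ F)) (from (Sat-embedᵖ ρ G)))
  Sat-embedᵖ ρ (F ⇒ G) =
    mk⇔ (λ x → to (Sat-embedᵖ ρ G) ∘ x ∘ from (Sat-embedᵖ ρ F))
        (λ x → from (Sat-embedᵖ ρ G) ∘ x ∘ to (Sat-embedᵖ ρ F))
  Sat-embedᵖ ρ (all F) =
    mk⇔ (λ x v → to (Sat-embedᵖ (v ∷ ρ) F) (x v)) (λ x v → from (Sat-embedᵖ (v ∷ ρ) F) (x v))
  Sat-embedᵖ ρ (ex F) =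
    mk⇔ (λ (v , x) → v , to (Sat-embedᵖ (v ∷ ρ) F) x)
        (λ (v , x) → v , from (Sat-embedᵖ (v ∷ ρ) F) x)

  -- Stated as a relation between `u` and `J` so that a single induction serves both directions of
  -- the theorem: one starts from `J` and restricts it, the other starts from `u` and builds `J`.
  record Corresponds (J : Pred (GroundAtom I) ℓ) : Set ℓ where
    field
      below   : J ⊆ trueAtoms I
      varied  : ∀ i xs → u i xs ⇔ J (p i ⟨ xs ⟩)
      outside : ∀ {a} → ¬ atomsOf I p a → trueAtoms I a → J a

  module _ (em : ExcludedMiddle ℓ) {J : Pred (GroundAtom I) ℓ} (c : Corresponds J) where

    open Corresponds c

    -- For a symbol among `p`, `varied` applies. For any other symbol, `outside` and `below` make
    -- `J` agree with `I`.
    Sat-star-pred : (ρ : Vec (Domain I) k) → ∀ q ts →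
                    Sat Iᵘ ρ (star p em (pred q ts)) ⇔ J (q ⟨ evals I ρ ts ⟩)
    Sat-star-pred ρ q ts with em {P = ∃ λ (i : Lift ℓ (Fin n)) → p (lower i) ≡ q}
    ... | yes (lift i , refl) =
      mk⇔ (λ x → to (varied i _) (subst (u i) (evals-assign ρ ts) x))
          (λ x → subst (u i) (sym (evals-assign ρ ts)) (from (varied i _) x))
    ... | no ¬i =
      mk⇔ (λ x → outside ¬i (subst (rel I q) (evals-assign ρ ts) x))
          (λ x → subst (rel I q) (sym (evals-assign ρ ts)) (below x))

    -- The implication case is the crux: the second conjunct of `star (F ⇒ G)` speaks of `I` alone
    -- and says exactly that the reduct keeps the implication instead of turning it into `⊥∞`.
    Sat-star : {ρ : Vec (Domain I) k} → ∀ {F P} → IsGrounding I ρ F P →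
               Sat Iᵘ ρ (star p em F) ⇔ (J ⊨ᵖ reductᵖ em (trueAtoms I) P)
    Sat-star ⊥′ = mk⇔ (λ ()) (λ ())
    Sat-star (pred {ρ = ρ} {q} {ts})
      with em {P = (q ⟨ evals I ρ ts ⟩) ∈ trueAtoms I}
    ... | yes _ = Sat-star-pred ρ q ts
    -- The reduct of an atom false in `I` is `⊥∞`, and `below` keeps such an atom out of `J` as
    -- well.
    ... | no ¬x = mk⇔ (λ x → contradiction (below (to (Sat-star-pred ρ q ts) x)) ¬x) (λ ())
    Sat-star (≈-yes {s = s} {t} eq) = mk⇔ (λ _ ()) (λ _ → from (Sat-≈-assign _ s t) eq)
    Sat-star (≈-no {s = s} {t} ¬eq) =
      mk⇔ (λ eq → contradiction (to (Sat-≈-assign _ s t) eq) ¬eq) (λ ())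
    Sat-star (f ∧ g) =
      mk⇔ (λ { (x , y) (lift true)  → to (Sat-star f) x
             ; (x , y) (lift false) → to (Sat-star g) y })
          (λ x → from (Sat-star f) (x (lift true)) , from (Sat-star g) (x (lift false)))
    Sat-star (f ∨ g) =
      mk⇔ (λ { (inj₁ x) → lift true  , to (Sat-star f) x
             ; (inj₂ y) → lift false , to (Sat-star g) y })
          (λ { (lift true  , x) → inj₁ (from (Sat-star f) x)
             ; (lift false , y) → inj₂ (from (Sat-star g) y) })
    Sat-star (_⇒_ {ρ = ρ} {F} {G} {P} {Q} f g) with em {P = trueAtoms I ⊨ᵖ (P ⟶ Q)}
    ... | yes y =
      mk⇔ (λ (x , _) → from (¬⊎-⇔-→ em) (to (Sat-star g) ∘ x ∘ from (Sat-star f)))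
          (λ x → (from (Sat-star g) ∘ to (¬⊎-⇔-→ em) x ∘ to (Sat-star f)) ,
                 from (Sat-embedᵖ ρ (F ⇒ G)) (from (Sat-⇔-⊨ᵖ I em (f ⇒ g)) y))
    ... | no ¬y =
      mk⇔ (λ (_ , x) →
             contradiction (to (Sat-⇔-⊨ᵖ I em (f ⇒ g)) (to (Sat-embedᵖ ρ (F ⇒ G)) x)) ¬y)
          (λ ())
    Sat-star (all f) =
      mk⇔ (λ x v → to (Sat-star (f v)) (x v)) (λ x v → from (Sat-star (f v)) (x v))
    Sat-star (ex f) =
      mk⇔ (λ (v , x) → v , to (Sat-star (f v)) x) (λ (v , x) → v , from (Sat-star (f v)) x)

  -- The set `J` built from `u`. As an inductive family it needs no decision whether a symbol is
  -- among `p`.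
  data Updated : Pred (GroundAtom I) ℓ where
    updated : ∀ {i xs} → u i xs → Updated (p i ⟨ xs ⟩)
    kept    : ∀ {a} → ¬ atomsOf I p a → trueAtoms I a → Updated a

  module _ (inj : Injective _≡_ _≡_ p) (u≤p : _≤ᵖ_ p I u (values p I)) where

    -- If two indices shared a symbol, an atom could enter through the other index, with values
    -- unrelated to `u i`; injectivity excludes this. The atom is generalised to `a` because
    -- matching `updated` directly would require unifying `p i` with `p j`.
    Updated-varied : ∀ {a} i xs → a ≡ (p i ⟨ xs ⟩) → Updated a → u i xs
    Updated-varied i xs eq (updated x) with inj (cong GroundAtom.symbol eq)
    Updated-varied i xs refl (updated x) | refl = x
    Updated-varied i xs refl (kept ¬i _) = contradiction (lift i , refl) ¬i

    Updated-corresponds : Corresponds Updated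
    Updated-corresponds = record
      { below   = λ { (updated x) → u≤p _ _ x ; (kept _ x) → x }
      ; varied  = λ i xs → mk⇔ updated (Updated-varied i xs refl)
      ; outside = kept
      }

-- Sets of atoms below the true atoms, and the equivalence of the two stability notions.

module _ {Σ : Signature ℓ} (em : ExcludedMiddle ℓ) (p : Fin n → Sym (predicate Σ))
         (I : Interpretation Σ) where

  restrict : Pred (GroundAtom I) ℓ → PredValues p I
  restrict J i xs = J (p i ⟨ xs ⟩)

  -- A true atom missing from `J` lies in the difference, hence is built from a symbol in `p`.
  ≤-outside : ∀ {J} → J ≤[ atomsOf I p ] trueAtoms I →
              ∀ {a} → ¬ atomsOf I p a → trueAtoms I a → J a
  ≤-outside {J} (_ , d) {a} ¬i x with em {P = J a}
  ... | yes y = y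
  ... | no ¬y = contradiction (d (x , ¬y)) ¬i

  restrict-corresponds : ∀ {J} → J ≤[ atomsOf I p ] trueAtoms I →
                         Corresponds p I (restrict J) J
  restrict-corresponds J≤I = record
    { below   = proj₁ J≤I
    ; varied  = λ _ _ → mk⇔ (λ x → x) (λ x → x)
    ; outside = ≤-outside J≤I
    }

  -- Makes strictness match on both sides: when `J` is a proper subset of the true atoms, its
  -- restriction must be strictly below the values of `p`.
  ≤-restrict⇒⊇ : ∀ {J} → J ≤[ atomsOf I p ] trueAtoms I →
                 _≤ᵖ_ p I (values p I) (restrict J) → trueAtoms I ⊆ J
  ≤-restrict⇒⊇ J≤I v {a} x with em {P = atomsOf I p a}
  ... | yes (lift i , refl) = v i _ x
  ... | no ¬i               = ≤-outside J≤I ¬i x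

  corresponds⇒≤ : ∀ {u J} → Corresponds p I u J → J ≤[ atomsOf I p ] trueAtoms I
  corresponds⇒≤ {J = J} c = below , diff
    where
    open Corresponds c
    diff : ∀ {a} → trueAtoms I a × ¬ J a → atomsOf I p a
    diff {a} (x , ¬y) with em {P = atomsOf I p a}
    ... | yes i = i
    ... | no ¬i = contradiction (outside ¬i x) ¬y

proposition2 : {ℓ : Level} (em : ExcludedMiddle ℓ)
    (Σ : Signature ℓ) (F : Sentence Σ)
    (n : ℕ) (p : Fin n → Sym (predicate Σ)) → Injective _≡_ _≡_ p →
    (I : Interpretation Σ) →
    IsPStableModel p em I F ⇔
    IsStableModel em (atomsOf I p) (trueAtoms I) (gr I em (embedᶠ F))
proposition2 em Σ F n p inj I = mk⇔ stable pStable
  where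
  g = gr-isGrounding I em F
  P = pre (gr I em (embedᶠ F))

  stable : IsPStableModel p em I F →
           IsStableModel em (atomsOf I p) (trueAtoms I) (gr I em (embedᶠ F))
  stable (sat , noSmaller) =
    from (⊨ᵖ-reduct-self em (trueAtoms I) P) (to (Sat-⇔-⊨ᵖ I em g) sat) , minimal
    where
    minimal : ∀ J → J ⊨ᵖ reductᵖ em (trueAtoms I) P →
              J ≤[ atomsOf I p ] trueAtoms I → J ≐ trueAtoms I
    -- The restriction of `J` is always at most `p`. Either the converse holds and `J` is all of the
    -- true atoms, or the restriction is a witness that `noSmaller` forbids.
    minimal J J⊨ J≤I with em {P = _≤ᵖ_ p I (values p I) (restrict em p I J)}
    ... | yes v = proj₁ J≤I , ≤-restrict⇒⊇ em p I J≤I v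
    ... | no ¬v = contradiction
      (restrict em p I J , ((λ _ _ → proj₁ J≤I) , ¬v) ,
       from (Sat-star p I _ em (restrict-corresponds em p I J≤I) g) J⊨)
      noSmaller

  pStable : IsStableModel em (atomsOf I p) (trueAtoms I) (gr I em (embedᶠ F)) →
            IsPStableModel p em I F
  pStable (I⊨ , minimal) =
    from (Sat-⇔-⊨ᵖ I em g) (to (⊨ᵖ-reduct-self em (trueAtoms I) P) I⊨) ,
    λ (u , (u≤p , ¬p≤u) , sat) →
      -- Minimality makes the set built from `u` equal to the true atoms. Its inclusion `I⊆J`, read
      -- through `varied`, gives the inequality that `u <ᵖ p` denies.
      let c        = Updated-corresponds p I u inj u≤p
          _ , I⊆J = minimal _ (to (Sat-star p I u em c g) sat) (corresponds⇒≤ em p I c)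
      in ¬p≤u λ i xs x → from (Corresponds.varied c i xs) (I⊆J x)
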